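{- Let $X\in S_n$ be a $k$-decomposable access sequence. Then the cost of \textsc{Greedy} on $X$ with a linear-cost preprocessing (in the geometric view: \textsc{Greedy} run without initial tree) is at most $n\,2^{O(k^2)}$, i.e. $|\textsc{Greedy}(X)|\le n\,2^{ck^2}$ for an absolute constant $c$.
   Context: Blocks and decomposability: for $\sigma\in S_\ell$, an interval $[a,b]\subseteq[\ell]$ is a block if $\{\sigma_a,\dots,\sigma_b\}$ is a set of consecutive integers. A permutation of length 1 is $k$-decomposable; $\sigma$ of length $\ell\ge 2$ is $k$-decomposable if $[\ell]$ can be partitioned into $m$ consecutive intervals, $2\le m\le k$, each a block, such that the permutation order-isomorphic to each restriction is $k$-decomposable. Geometric model: $X=(x_1,\dots,x_n)$ is the set of access points $\{(x_t,t)\}$ (key, time). $\square_{pq}$ is the closed axis-parallel rectangle with corners $p,q$. \textsc{Greedy} without initial tree: let $\tau(b,t)$ be the largest time $\le t$ at which column $b$ contains an output point (undefined if none). At time $t$ with access $(a,t)$, add $(a,t)$ and $(b,t)$ for each $b\ne a$ with $\tau(b,t-1)$ defined such that $\square_{(a,t),(b,\tau(b,t-1))}$ contains no output point at times $<t$ other than $(b,\tau(b,t-1))$. $\textsc{Greedy}(X)$ is the output set, and its size is the cost. The preprocessing (putting keys in a split tree before the first access) corresponds exactly to running \textsc{Greedy} in this geometric view with no initial-tree points. -}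

module Defs where

open import Data.Nat using (ℕ; zero; suc; _+_; _≤_; _<ᵇ_; _≤ᵇ_; _≡ᵇ_; _⊔_; _⊓_)
open import Data.Bool using (Bool; true; false; _∧_; not; if_then_else_)
open import Data.Maybe using (Maybe; just; nothing)
open import Data.Product using (_×_; _,_; ∃-syntax)
open import Data.List using (List; []; _∷_; [_]; length; map; filter; concat; concatMap; upTo; applyUpTo; foldr; _++_)
open import Data.List.Relation.Unary.All using (All)
open import Data.List.Relation.Binary.Permutation.Propositional using (_↭_)
open import Relation.Binary.PropositionalEquality using (_≡_)

-- Permutations are lists of distinct naturals; S_n = permutations of
-- [0, 1, ..., n-1] (0-based keys).

std : List ℕ → List ℕ
std xs = map (λ x → length (filter (λ y → Data.Nat._<?_ y x) xs)) xs

Consecutive : List ℕ → Set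
Consecutive xs = ∃[ a ] (xs ↭ applyUpTo (a +_) (length xs))

NonEmpty : List ℕ → Set
NonEmpty xs = 1 ≤ length xs

-- k-decomposability. A partition of [ℓ] into consecutive intervals is a
-- list of nonempty lists whose concatenation is σ; each interval is a
-- block iff its values are consecutive integers; the pattern of each
-- restriction is 'std' of the interval.
data KDecomposable (k : ℕ) : List ℕ → Set where
  single : ∀ x → KDecomposable k [ x ]
  split  : ∀ (σ : List ℕ) (parts : List (List ℕ))
         → concat parts ≡ σ
         → 2 ≤ length parts
         → length parts ≤ k
         → All NonEmpty parts
         → All Consecutive parts
         → All (λ p → KDecomposable k (std p)) parts
         → KDecomposable k σ

-- Geometric Greedy without initial tree.
-- Points are (key , time).

Point : Set
Point = ℕ × ℕ

tau : List Point → ℕ → Maybe ℕ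
tau []            b = nothing
tau ((x , s) ∷ P) b with tau P b | x ≡ᵇ b
... | r        | false = r
... | nothing  | true  = just s
... | just r   | true  = just (s ⊔ r)

inRect : ℕ → ℕ → ℕ → ℕ → Point → Bool
inRect a t b u (x , s) =
  ((a ⊓ b) ≤ᵇ x) ∧ (x ≤ᵇ (a ⊔ b)) ∧ ((t ⊓ u) ≤ᵇ s) ∧ (s ≤ᵇ (t ⊔ u))

samePoint : Point → Point → Bool
samePoint (x , s) (y , u) = (x ≡ᵇ y) ∧ (s ≡ᵇ u)

allB : {A : Set} → (A → Bool) → List A → Bool
allB p []       = true
allB p (x ∷ xs) = p x ∧ allB p xs

-- times of all points in P are < t when this is called
touched : List Point → ℕ → ℕ → ℕ → Bool
touched P t a b with a ≡ᵇ b | tau P b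
... | true  | _        = false
... | false | nothing  = false
... | false | just u   =
  allB (λ q → not (inRect a t b u q) Data.Bool.∨ samePoint q (b , u)) P

step : List Point → ℕ → ℕ → List ℕ → List Point
step P t a cols = (a , t) ∷ map (λ b → (b , t)) (filter (λ b → Data.Bool.T? (touched P t a b)) cols)

run : List ℕ → List Point → ℕ → List ℕ → List Point
run cols P t []       = P
run cols P t (a ∷ xs) = run cols (P ++ step P t a cols) (suc t) xs

-- Greedy(X): all columns that could ever contain a point are keys ≤ max X.
greedy : List ℕ → List Point
greedy X = run (upTo (suc (foldr _⊔_ 0 X))) [] 0 X

greedyCost : List ℕ → ℕ
greedyCost X = length (greedy X)

{-# OPTIONS --safe #-}
module Submission where

-- The bound proved is (2k+5) n. Greedy only depends on the last touch time of each column: an access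
-- a touches c iff c was touched strictly later than every column on the way from a to c.
-- Call a column of a block exposed from the left (right) if it was touched later than all columns of
-- the block to its left (right), and let the potential of a finished block be the number of such
-- exposures. An access outside the block touches only columns exposed to its side, and afterwards all
-- of them but one are hidden, while at most one column becomes exposed to the other side; so its
-- amortised cost is at most 2 per block touched. The potential of a union of blocks is at most the
-- sum of the potentials.
-- It remains to count touched blocks. The first access inside a block B touches the nearest
-- column on each side of B, which then hides everything beyond it as long as accesses stay in B:
-- any later access in B touches at most one column outside B on each side. Hence the first
-- access of a non-first part of B touches at most k - 1 sibling blocks and two columns outside B.

open import Defs
open import Data.Nat using (ℕ; zero; suc; _+_; _≤_; _<_; _>_; _*_; _^_; _⊔_; _⊓_; _≡ᵇ_; _≤ᵇ_; z≤n; s≤s; z<s; _≟_; _<?_; _>?_; _≤?_; ∣_-_∣)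
open import Data.Nat.Properties
open import Data.Nat.Induction using (<-wellFounded)
open import Data.Nat.Tactic.RingSolver using (solve-∀)
open import Data.Product using (map₂; ∃-syntax; _×_; _,_; proj₁; proj₂)
open import Data.Sum using (_⊎_; inj₁; inj₂)
open import Data.Bool using (Bool; true; false; T; T?; not; _∨_)
open import Data.Bool.Properties using (T-∧)
open import Data.Empty using (⊥-elim)
open import Data.Maybe using (just; nothing; maybe′)
open import Data.List using (List; []; _∷_; [_]; _++_; map; concat; length; upTo; applyUpTo; filter; foldr)
open import Data.List.Properties using (map-cong; map-∘; map-id-local; map-upTo; concat-map; concat-++; length-++; length-map; length-upTo; ++-assoc; ++-identityʳ; filter-accept; filter-none)
open import Data.List.Membership.Propositional using (_∈_; _∉_)
open import Data.List.Membership.Propositional.Properties using (∈-applyUpTo⁺; ∈-applyUpTo⁻; ∈-++⁺ˡ; ∈-++⁺ʳ; ∈-++⁻; ∈-concat⁺′; ∈-map⁺; ∈-map⁻; ∈-filter⁺; ∈-filter⁻; ∈-upTo⁺; ∈-upTo⁻)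
open import Data.List.Relation.Unary.Any using (here; there)
open import Data.List.Relation.Unary.All as All using (All; []; _∷_; all?; lookup)
open import Data.List.Relation.Unary.All.Properties as Allₚ using ()
open import Data.List.Relation.Unary.AllPairs using ([]; _∷_)
open import Data.List.Relation.Unary.Unique.Propositional using (Unique)
open import Data.List.Relation.Unary.Unique.Propositional.Properties using (applyUpTo⁺₁; upTo⁺)
open import Data.List.Relation.Binary.Permutation.Propositional as ↭ using (_↭_; ↭-sym; ↭-trans; ↭-reflexive; ↭⇒↭ₛ)
open import Data.List.Relation.Binary.Permutation.Propositional.Properties using (∈-resp-↭; shifts; map⁺; filter-↭; ↭-length)
open import Data.List.Relation.Binary.Permutation.Setoid.Properties using (Unique-resp-↭)
open import Function using (_∘_; Equivalence)
open import Induction.WellFounded using (Acc; acc)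
open import Relation.Binary using (Rel; Decidable; tri<; tri≈; tri>)
open import Relation.Binary.PropositionalEquality using (_≡_; _≢_; refl; sym; trans; cong; cong₂; subst; setoid; module ≡-Reasoning)
open import Relation.Nullary using (Dec; yes; no; ¬_; contradiction)
open import Relation.Nullary.Decidable using (_×-dec_; _⊎-dec_; _→-dec_; ¬?)
open import Level using (0ℓ)

-- Counting

⟦_⟧ : {P : Set} → Dec P → ℕ
⟦ yes _ ⟧ = 1
⟦ no  _ ⟧ = 0

⟦⟧≤1 : {P : Set} (p : Dec P) → ⟦ p ⟧ ≤ 1
⟦⟧≤1 (yes _) = ≤-refl
⟦⟧≤1 (no  _) = z≤n

⟦⟧-mono : {P Q : Set} (p : Dec P) (q : Dec Q) → (P → Q) → ⟦ p ⟧ ≤ ⟦ q ⟧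
⟦⟧-mono (no _)  q       f = z≤n
⟦⟧-mono (yes p) (yes q) f = ≤-refl
⟦⟧-mono (yes p) (no ¬q) f = contradiction (f p) ¬q

⟦⟧-false : {P : Set} (p : Dec P) → ¬ P → ⟦ p ⟧ ≡ 0
⟦⟧-false (yes p) ¬p = contradiction p ¬p
⟦⟧-false (no _)  ¬p = refl

⟦⟧-true : {P : Set} (p : Dec P) → P → ⟦ p ⟧ ≡ 1
⟦⟧-true (yes _) p = refl
⟦⟧-true (no ¬p) p = contradiction p ¬p

∑ : {A : Set} → (A → ℕ) → List A → ℕ
∑ f []       = 0
∑ f (x ∷ xs) = f x + ∑ f xs

module _ {A : Set} where

  ∑-++ : ∀ (f : A → ℕ) xs ys → ∑ f (xs ++ ys) ≡ ∑ f xs + ∑ f ys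
  ∑-++ f []       ys = refl
  ∑-++ f (x ∷ xs) ys = trans (cong (f x +_) (∑-++ f xs ys)) (sym (+-assoc (f x) _ _))

  ∑-↭ : ∀ (f : A → ℕ) {xs ys} → xs ↭ ys → ∑ f xs ≡ ∑ f ys
  ∑-↭ f ↭.refl         = refl
  ∑-↭ f (↭.prep x p)   = cong (f x +_) (∑-↭ f p)
  ∑-↭ f (↭.swap {ys = ys} x y p) rewrite ∑-↭ f p = exchange (f x) (f y) (∑ f ys)
    where
    exchange : ∀ a b c → a + (b + c) ≡ b + (a + c)
    exchange = solve-∀
  ∑-↭ f (↭.trans p q)  = trans (∑-↭ f p) (∑-↭ f q)

  ∑-+ : ∀ (f g : A → ℕ) xs → ∑ (λ x → f x + g x) xs ≡ ∑ f xs + ∑ g xs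
  ∑-+ f g []       = refl
  ∑-+ f g (x ∷ xs) rewrite ∑-+ f g xs = interchange (f x) (g x) (∑ f xs) (∑ g xs)
    where
    interchange : ∀ a b c d → a + b + (c + d) ≡ a + c + (b + d)
    interchange = solve-∀

  ∑-mono : ∀ {f g : A → ℕ} xs → (∀ {x} → x ∈ xs → f x ≤ g x) → ∑ f xs ≤ ∑ g xs
  ∑-mono []       h = z≤n
  ∑-mono (x ∷ xs) h = +-mono-≤ (h (here refl)) (∑-mono xs (h ∘ there))

  ∑-zero : ∀ {f : A → ℕ} xs → (∀ {x} → x ∈ xs → f x ≡ 0) → ∑ f xs ≡ 0
  ∑-zero []       h = refl
  ∑-zero (x ∷ xs) h = cong₂ _+_ (h (here refl)) (∑-zero xs (h ∘ there))

  ∑-const : ∀ {f : A → ℕ} {m} xs → (∀ {x} → x ∈ xs → f x ≤ m) → ∑ f xs ≤ m * length xs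
  ∑-const {m = m} []       h = z≤n
  ∑-const {m = m} (x ∷ xs) h rewrite *-suc m (length xs) =
    +-mono-≤ (h (here refl)) (∑-const xs (h ∘ there))

  ∑-concat : ∀ (f : A → ℕ) xss → ∑ f (concat xss) ≡ ∑ (∑ f) xss
  ∑-concat f []         = refl
  ∑-concat f (xs ∷ xss) = trans (∑-++ f xs (concat xss)) (cong (∑ f xs +_) (∑-concat f xss))

  ∑-unique : ∀ {P : A → Set} (P? : ∀ x → Dec (P x)) {xs} → Unique xs →
             (∀ {x y} → x ∈ xs → y ∈ xs → P x → P y → x ≡ y) → ∑ (λ x → ⟦ P? x ⟧) xs ≤ 1
  ∑-unique P? []           h = z≤n
  ∑-unique P? {x ∷ xs} (x≢ ∷ xs!) h with P? x
  ... | no  _  = ∑-unique P? xs! λ x∈ y∈ → h (there x∈) (there y∈)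
  ... | yes px = s≤s (≤-reflexive (∑-zero xs λ {y} y∈ →
                   ⟦⟧-false (P? y) λ py → lookup x≢ y∈ (h (here refl) (there y∈) px py)))

  length-filter≤∑ : ∀ {P Q : A → Set} (P? : ∀ x → Dec (P x)) (Q? : ∀ x → Dec (Q x)) → (∀ {x} → P x → Q x) →
                    ∀ xs → length (filter P? xs) ≤ ∑ (λ x → ⟦ Q? x ⟧) xs
  length-filter≤∑ P? Q? P⇒Q []       = z≤n
  length-filter≤∑ P? Q? P⇒Q (x ∷ xs) with P? x
  ... | yes px = +-mono-≤ (≤-reflexive (sym (⟦⟧-true (Q? x) (P⇒Q px)))) (length-filter≤∑ P? Q? P⇒Q xs)
  ... | no  _  = ≤-trans (length-filter≤∑ P? Q? P⇒Q xs) (m≤n+m _ _)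

  unique-++⁻ʳ : ∀ xs {ys : List A} → Unique (xs ++ ys) → Unique ys
  unique-++⁻ʳ []       u       = u
  unique-++⁻ʳ (x ∷ xs) (_ ∷ u) = unique-++⁻ʳ xs u

  unique-++⇒∉ : ∀ xs {ys : List A} {x} → Unique (xs ++ ys) → x ∈ xs → x ∉ ys
  unique-++⇒∉ (x ∷ xs) (x≢ ∷ _) (here refl) x∈ys = lookup x≢ (∈-++⁺ʳ xs x∈ys) refl
  unique-++⇒∉ (x ∷ xs) (_ ∷ u)  (there x∈)  x∈ys = unique-++⇒∉ xs u x∈ x∈ys

  concat-extract : ∀ (pre : List (List A)) p {rest} → concat (pre ++ p ∷ rest) ↭ p ++ concat (pre ++ rest)
  concat-extract pre p {rest} = ↭-trans (↭-reflexive (sym (concat-++ pre (p ∷ rest))))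
    (↭-trans (shifts (concat pre) p) (↭-reflexive (cong (p ++_) (concat-++ pre rest))))

-- Consecutive sets of keys

OneSided : ℕ → List ℕ → Set
OneSided c D = (∀ {d} → d ∈ D → c < d) ⊎ (∀ {d} → d ∈ D → d < c)

consecutive⇒unique : ∀ {D} → Consecutive D → Unique D
consecutive⇒unique (lo , p) = Unique-resp-↭ (setoid ℕ) (↭⇒↭ₛ (↭-sym p))
  (applyUpTo⁺₁ (lo +_) _ λ i<j _ eq → <⇒≢ i<j (+-cancelˡ-≡ lo _ _ eq))

consecutive⇒oneSided : ∀ {D c} → Consecutive D → c ∉ D → OneSided c D
consecutive⇒oneSided {D} {c} (lo , p) c∉ with c <? lo | c <? lo + length D
... | yes c<lo | _ = inj₁ λ d∈ → let _ , _ , eq = ∈-applyUpTo⁻ (lo +_) (∈-resp-↭ p d∈) in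
  <-≤-trans c<lo (≤-trans (m≤m+n lo _) (≤-reflexive (sym eq)))
... | no _ | no c≮hi = inj₂ λ d∈ → let _ , i< , eq = ∈-applyUpTo⁻ (lo +_) (∈-resp-↭ p d∈) in
  <-≤-trans (≤-<-trans (≤-reflexive eq) (+-monoʳ-< lo i<)) (≮⇒≥ c≮hi)
... | no c≮lo | yes c<hi = contradiction (∈-resp-↭ (↭-sym p) c∈) c∉
  where
  lo≤c : lo ≤ c
  lo≤c = ≮⇒≥ c≮lo
  c∈ : c ∈ applyUpTo (lo +_) (length D)
  c∈ = subst (_∈ applyUpTo (lo +_) (length D)) (m+[n∸m]≡n lo≤c)
         (∈-applyUpTo⁺ (lo +_) (+-cancelˡ-< lo _ _ (subst (_< lo + length D) (sym (m+[n∸m]≡n lo≤c)) c<hi)))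

-- The greedy step on last-touch times

-- One more than the time of the last touch of a column, and 0 if there is none.
State : Set
State = ℕ → ℕ

-- Half-open: the start `a` counts, the target `c` does not. So the way from `a` to itself is empty,
-- and `Touched τ a a` says only that `a` was touched before.
OnWay : ℕ → ℕ → ℕ → Set
OnWay a c d = (a ≤ d × d < c) ⊎ (c < d × d ≤ a)

onWay? : ∀ a c d → Dec (OnWay a c d)
onWay? a c d = ((a ≤? d) ×-dec (d <? c)) ⊎-dec ((c <? d) ×-dec (d ≤? a))

onWay-bound : ∀ {a c d} → OnWay a c d → d < suc (a ⊔ c)
onWay-bound {a} {c} (inj₁ (_ , d<c)) = m≤n⇒m≤1+n (≤-trans d<c (m≤n⊔m a c))
onWay-bound {a} {c} (inj₂ (_ , d≤a)) = s≤s (≤-trans d≤a (m≤m⊔n a c))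

onWay-trans : ∀ {a c d e} → OnWay a c d → OnWay a d e → OnWay a c e
onWay-trans (inj₁ (_ , d<c))   (inj₁ (a≤e , e<d)) = inj₁ (a≤e , <-trans e<d d<c)
onWay-trans (inj₁ (a≤d , _))   (inj₂ (d<e , e≤a)) = contradiction (<-≤-trans d<e e≤a) (≤⇒≯ a≤d)
onWay-trans (inj₂ (_ , d≤a))   (inj₁ (a≤e , e<d)) = contradiction (<-≤-trans e<d d≤a) (≤⇒≯ a≤e)
onWay-trans (inj₂ (c<d , _))   (inj₂ (d<e , e≤a)) = inj₂ (<-trans c<d d<e , e≤a)

onWay-closer : ∀ {a c d} → OnWay a c d → ∣ a - d ∣ < ∣ a - c ∣
onWay-closer (inj₁ (a≤d , d<c))
  rewrite m≤n⇒∣m-n∣≡n∸m a≤d | m≤n⇒∣m-n∣≡n∸m (≤-trans a≤d (<⇒≤ d<c)) = ∸-monoˡ-< d<c a≤d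
onWay-closer (inj₂ (c<d , d≤a))
  rewrite m≤n⇒∣n-m∣≡n∸m d≤a | m≤n⇒∣n-m∣≡n∸m (≤-trans (<⇒≤ c<d) d≤a) = ∸-monoʳ-< c<d d≤a

Touched : State → ℕ → ℕ → Set
Touched τ a c = 0 < τ c × (∀ {d} → OnWay a c d → τ d < τ c)

touched-or-blocked : ∀ τ a c → 0 < τ c → Touched τ a c ⊎ ∃[ d ] (OnWay a c d × τ c ≤ τ d)
touched-or-blocked τ a c 0<τc
  with anyUpTo? (λ d → onWay? a c d ×-dec (τ c ≤? τ d)) (suc (a ⊔ c))
... | yes (d , _ , w , le) = inj₂ (d , w , le)
... | no  none             = inj₁ (0<τc , λ w → ≰⇒> λ le → none (_ , onWay-bound w , w , le))

touched? : ∀ τ a c → Dec (Touched τ a c)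
touched? τ a c with 0 <? τ c
... | no  τc≯0 = no (τc≯0 ∘ proj₁)
... | yes 0<τc with touched-or-blocked τ a c 0<τc
...   | inj₁ t            = yes t
...   | inj₂ (d , w , le) = no λ t → ≤⇒≯ le (proj₂ t w)

-- A column that is not touched has a blocker nearer to `a` with at least as late a time. Following
-- blockers inwards terminates, and the time stays positive.
touched-towards : ∀ τ a c → 0 < τ c → ∃[ d ] (Touched τ a d × (d ≡ c ⊎ OnWay a c d))
touched-towards τ a c = go c (<-wellFounded _)
  where
  go : ∀ c → Acc _<_ ∣ a - c ∣ → 0 < τ c → ∃[ d ] (Touched τ a d × (d ≡ c ⊎ OnWay a c d))
  go c (acc rec) 0<τc with touched-or-blocked τ a c 0<τc
  ... | inj₁ t = c , t , inj₁ refl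
  ... | inj₂ (d , w , le) with go d (rec (onWay-closer w)) (<-≤-trans 0<τc le)
  ...   | e , t , inj₁ refl = e , t , inj₂ w
  ...   | e , t , inj₂ w′   = e , t , inj₂ (onWay-trans w w′)

-- All that the analysis uses of a greedy step: the touched columns share one time, later than every
-- time before.
record Step (τ : State) (a : ℕ) (τ′ : State) : Set where
  field
    now       : ℕ
    τ<now     : ∀ c → τ c < now
    accessed  : τ′ a ≡ now
    renewed   : ∀ {c} → Touched τ a c → τ′ c ≡ now
    unchanged : ∀ {c} → c ≢ a → ¬ Touched τ a c → τ′ c ≡ τ c

  τ≤τ′ : ∀ c → τ c ≤ τ′ c
  τ≤τ′ c with c ≟ a | touched? τ a c
  ... | yes refl | _     = ≤-trans (<⇒≤ (τ<now c)) (≤-reflexive (sym accessed))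
  ... | no _     | yes t = ≤-trans (<⇒≤ (τ<now c)) (≤-reflexive (sym (renewed t)))
  ... | no c≢a   | no ¬t = ≤-reflexive (sym (unchanged c≢a ¬t))

  zero-stays : ∀ {c} → c ≢ a → τ c ≡ 0 → τ′ c ≡ 0
  zero-stays c≢a z = trans (unchanged c≢a λ t → <-irrefl (sym z) (proj₁ t)) z

touches : List ℕ → State → ℕ → ℕ
touches xs τ a = ∑ (λ c → ⟦ touched? τ a c ⟧) xs

module _ (cols : List ℕ) where

  data Run : State → List ℕ → State → ℕ → Set where
    []  : ∀ {τ} → Run τ [] τ 0
    _∷_ : ∀ {τ a τ′ xs τ″ w} → Step τ a τ′ → Run τ′ xs τ″ w →
          Run τ (a ∷ xs) τ″ (suc (touches cols τ a) + w)

  run-++⁻ : ∀ xs {ys τ τ″ w} → Run τ (xs ++ ys) τ″ w →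
            ∃[ τ′ ] ∃[ w₁ ] ∃[ w₂ ] (Run τ xs τ′ w₁ × Run τ′ ys τ″ w₂ × w ≡ w₁ + w₂)
  run-++⁻ []       r       = _ , _ , _ , [] , r , refl
  run-++⁻ (x ∷ xs) (s ∷ r) with run-++⁻ xs r
  ... | _ , w₁ , w₂ , r₁ , r₂ , refl = _ , _ , w₂ , s ∷ r₁ , r₂ , sym (+-assoc _ w₁ w₂)

  run-zero : ∀ {xs τ τ′ w c} → Run τ xs τ′ w → c ∉ xs → τ c ≡ 0 → τ′ c ≡ 0
  run-zero []      c∉ z = z
  run-zero (s ∷ r) c∉ z = run-zero r (c∉ ∘ there) (Step.zero-stays s (c∉ ∘ here) z)

-- Potential of a segment

-- With `_<_` exposure is from the left, with `_>_` from the right. `Extreme` picks the first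
-- touched column of `D` from that side.
module Direction (_≺_ : Rel ℕ 0ℓ) (_≺?_ : Decidable _≺_) where

  Exposed : List ℕ → State → ℕ → Set
  Exposed D τ c = 0 < τ c × All (λ d → d ≺ c → τ d < τ c) D

  exposed? : ∀ D τ c → Dec (Exposed D τ c)
  exposed? D τ c = (0 <? τ c) ×-dec all? (λ d → (d ≺? c) →-dec (τ d <? τ c)) D

  Extreme : List ℕ → State → ℕ → ℕ → Set
  Extreme D τ a c = Touched τ a c × All (λ d → d ≺ c → ¬ Touched τ a d) D

  extreme? : ∀ D τ a c → Dec (Extreme D τ a c)
  extreme? D τ a c = touched? τ a c ×-dec all? (λ d → (d ≺? c) →-dec ¬? (touched? τ a d)) D

  module _ {τ a τ′} (s : Step τ a τ′) where
    open Step s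

    -- Columns touched in one step end with equal times, so an exposed one has no other touched
    -- column of `D` in front of it.
    exposed⇒extreme : ∀ {D c} → Touched τ a c → Exposed D τ′ c → Extreme D τ a c
    exposed⇒extreme t (_ , ex) = t ,
      All.map (λ f d≺c t′ → <-irrefl (trans (renewed t′) (sym (renewed t))) (f d≺c)) ex

    exposed-back : ∀ {D c} → c ≢ a → ¬ Touched τ a c → Exposed D τ′ c → Exposed D τ c
    exposed-back {D} {c} c≢a ¬t (pos , ex) rewrite unchanged c≢a ¬t =
      pos , All.map (λ f d≺c → ≤-<-trans (τ≤τ′ _) (f d≺c)) ex

    -- For the side of `D` away from the access: only the extreme touched column can become newly
    -- exposed.
    exposed-step : ∀ D {c} → c ≢ a →
      ⟦ exposed? D τ′ c ⟧ ≤ ⟦ exposed? D τ c ⟧ + ⟦ extreme? D τ a c ⟧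
    exposed-step D {c} c≢a with touched? τ a c
    ... | no ¬t = ≤-trans (⟦⟧-mono (exposed? D τ′ c) (exposed? D τ c) (exposed-back c≢a ¬t)) (m≤m+n _ _)
    ... | yes t = ≤-trans (⟦⟧-mono (exposed? D τ′ c) ext (exposed⇒extreme t)) (m≤n+m _ _)
      -- `ext` is what `extreme? D τ a c` becomes once `touched? τ a c` is replaced by `yes t`.
      where ext = yes t ×-dec all? (λ d → (d ≺? c) →-dec ¬? (touched? τ a d)) D

    -- For the side facing the access: the old exposure of a touched column pays for the touch, and
    -- exposure afterwards is left only to the extreme one.
    touched-step : ∀ D {c} → c ≢ a → (Touched τ a c → Exposed D τ c) →
      ⟦ touched? τ a c ⟧ + ⟦ exposed? D τ′ c ⟧ ≤ ⟦ exposed? D τ c ⟧ + ⟦ extreme? D τ a c ⟧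
    touched-step D {c} c≢a t⇒e with touched? τ a c
    ... | no ¬t = ≤-trans (⟦⟧-mono (exposed? D τ′ c) (exposed? D τ c) (exposed-back c≢a ¬t)) (m≤m+n _ _)
    ... | yes t = +-mono-≤ (≤-reflexive (sym (⟦⟧-true (exposed? D τ c) (t⇒e t))))
                           (⟦⟧-mono (exposed? D τ′ c) ext (exposed⇒extreme t))
      where ext = yes t ×-dec all? (λ d → (d ≺? c) →-dec ¬? (touched? τ a d)) D

module L = Direction _<_ _<?_
module R = Direction _>_ _>?_

ψ : List ℕ → State → ℕ → ℕ
ψ D τ c = ⟦ L.exposed? D τ c ⟧ + ⟦ R.exposed? D τ c ⟧

ξ : List ℕ → State → ℕ → ℕ → ℕ
ξ D τ a c = ⟦ L.extreme? D τ a c ⟧ + ⟦ R.extreme? D τ a c ⟧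

potential : List ℕ → State → ℕ
potential D τ = ∑ (ψ D τ) D

extremes : List ℕ → State → ℕ → ℕ
extremes D τ a = ∑ (ξ D τ a) D

Φ : List (List ℕ) → State → ℕ
Φ Ds τ = ∑ (λ D → potential D τ) Ds

Ξ : List (List ℕ) → State → ℕ → ℕ
Ξ Ds τ a = ∑ (λ D → extremes D τ a) Ds

-- If `a` is left of `D`, the columns of `D` before `c` are on the way from `a` to `c`, so a touched
-- `c` was exposed from the left. `L.touched-step` then pays for the touches and `R.exposed-step`
-- covers the far side; the other case is the mirror image.
amortised : ∀ {τ a τ′ D} → Step τ a τ′ → OneSided a D →
            touches D τ a + potential D τ′ ≤ potential D τ + extremes D τ a
amortised {τ} {a} {τ′} {D} s side = begin
  touches D τ a + potential D τ′                 ≡⟨ ∑-+ _ _ D ⟨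
  ∑ (λ c → ⟦ touched? τ a c ⟧ + ψ D τ′ c) D      ≤⟨ ∑-mono D (pointwise side) ⟩
  ∑ (λ c → ψ D τ c + ξ D τ a c) D                ≡⟨ ∑-+ _ _ D ⟩
  potential D τ + extremes D τ a                 ∎
  where
  open ≤-Reasoning
  groupˡ : ∀ t l r → t + (l + r) ≡ t + l + r
  groupˡ = solve-∀
  groupʳ : ∀ t l r → t + (l + r) ≡ l + (t + r)
  groupʳ = solve-∀
  regroup : ∀ l m r n → l + m + (r + n) ≡ l + r + (m + n)
  regroup = solve-∀
  pointwise : OneSided a D → ∀ {c} → c ∈ D → ⟦ touched? τ a c ⟧ + ψ D τ′ c ≤ ψ D τ c + ξ D τ a c
  pointwise (inj₁ a<) {c} c∈ = begin
    ⟦ touched? τ a c ⟧ + ψ D τ′ c  ≡⟨ groupˡ ⟦ touched? τ a c ⟧ ⟦ L.exposed? D τ′ c ⟧ _ ⟩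
    _                              ≤⟨ +-mono-≤
      (L.touched-step s D (>⇒≢ (a< c∈)) λ (pos , h) → pos , All.tabulate λ d∈ d<c → h (inj₁ (<⇒≤ (a< d∈) , d<c)))
      (R.exposed-step s D (>⇒≢ (a< c∈))) ⟩
    _                              ≡⟨ regroup ⟦ L.exposed? D τ c ⟧ _ _ _ ⟩
    ψ D τ c + ξ D τ a c            ∎
  pointwise (inj₂ <a) {c} c∈ = begin
    ⟦ touched? τ a c ⟧ + ψ D τ′ c  ≡⟨ groupʳ ⟦ touched? τ a c ⟧ ⟦ L.exposed? D τ′ c ⟧ _ ⟩
    _                              ≤⟨ +-mono-≤
      (L.exposed-step s D (<⇒≢ (<a c∈)))
      (R.touched-step s D (<⇒≢ (<a c∈)) λ (pos , h) → pos , All.tabulate λ d∈ c<d → h (inj₂ (c<d , <⇒≤ (<a d∈)))) ⟩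
    _                              ≡⟨ regroup ⟦ L.exposed? D τ c ⟧ _ _ _ ⟩
    ψ D τ c + ξ D τ a c            ∎

amortised-all : ∀ {τ a τ′} Ds → Step τ a τ′ → (∀ {D} → D ∈ Ds → OneSided a D) →
                touches (concat Ds) τ a + Φ Ds τ′ ≤ Φ Ds τ + Ξ Ds τ a
amortised-all {τ} {a} {τ′} Ds s side = begin
  touches (concat Ds) τ a + Φ Ds τ′                   ≡⟨ cong (_+ Φ Ds τ′) (∑-concat _ Ds) ⟩
  ∑ (λ D → touches D τ a) Ds + Φ Ds τ′                ≡⟨ ∑-+ _ _ Ds ⟨
  ∑ (λ D → touches D τ a + potential D τ′) Ds         ≤⟨ ∑-mono Ds (λ D∈ → amortised s (side D∈)) ⟩
  ∑ (λ D → potential D τ + extremes D τ a) Ds         ≡⟨ ∑-+ _ _ Ds ⟩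
  Φ Ds τ + Ξ Ds τ a                                   ∎
  where open ≤-Reasoning

-- Being exposed in the union demands more than being exposed in the part that contains the column.
potential-concat : ∀ τ parts → potential (concat parts) τ ≤ Φ parts τ
potential-concat τ parts = ≤-trans (≤-reflexive (∑-concat _ parts)) (∑-mono parts λ {D} D∈ →
  ∑-mono D λ {c} c∈ → +-mono-≤
    (⟦⟧-mono (L.exposed? (concat parts) τ c) (L.exposed? D τ c) (λ (pos , h) → pos , restrict D∈ h))
    (⟦⟧-mono (R.exposed? (concat parts) τ c) (R.exposed? D τ c) (λ (pos , h) → pos , restrict D∈ h)))
  where
  restrict : ∀ {P : ℕ → Set} {D} → D ∈ parts → All P (concat parts) → All P D
  restrict D∈ h = lookup (Allₚ.concat⁻ h) D∈

zero⇒potential≡0 : ∀ {τ} D → (∀ {c} → c ∈ D → τ c ≡ 0) → potential D τ ≡ 0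
zero⇒potential≡0 {τ} D z = ∑-zero D λ {c} c∈ → cong₂ _+_
  (⟦⟧-false (L.exposed? D τ c) λ e → <-irrefl (sym (z c∈)) (proj₁ e))
  (⟦⟧-false (R.exposed? D τ c) λ e → <-irrefl (sym (z c∈)) (proj₁ e))

zero⇒extremes≡0 : ∀ {τ a} D → (∀ {c} → c ∈ D → τ c ≡ 0) → extremes D τ a ≡ 0
zero⇒extremes≡0 {τ} {a} D z = ∑-zero D λ {c} c∈ → cong₂ _+_
  (⟦⟧-false (L.extreme? D τ a c) λ e → <-irrefl (sym (z c∈)) (proj₁ (proj₁ e)))
  (⟦⟧-false (R.extreme? D τ a c) λ e → <-irrefl (sym (z c∈)) (proj₁ (proj₁ e)))

extremes≤2 : ∀ {τ a D} → Unique D → extremes D τ a ≤ 2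
extremes≤2 {τ} {a} {D} D! = ≤-trans (≤-reflexive (∑-+ _ _ D)) (+-mono-≤
  (∑-unique (L.extreme? D τ a) D! leftmost-unique)
  (∑-unique (R.extreme? D τ a) D! rightmost-unique))
  where
  leftmost-unique : ∀ {c d} → c ∈ D → d ∈ D → L.Extreme D τ a c → L.Extreme D τ a d → c ≡ d
  leftmost-unique {c} {d} c∈ d∈ (tc , hc) (td , hd) with <-cmp c d
  ... | tri< c<d _ _ = contradiction tc (lookup hd c∈ c<d)
  ... | tri≈ _ eq _  = eq
  ... | tri> _ _ d<c = contradiction td (lookup hc d∈ d<c)
  rightmost-unique : ∀ {c d} → c ∈ D → d ∈ D → R.Extreme D τ a c → R.Extreme D τ a d → c ≡ d
  rightmost-unique {c} {d} c∈ d∈ (tc , hc) (td , hd) with <-cmp c d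
  ... | tri< c<d _ _ = contradiction td (lookup hc d∈ c<d)
  ... | tri≈ _ eq _  = eq
  ... | tri> _ _ d<c = contradiction tc (lookup hd c∈ d<c)

-- Meant for the segments outside the parent block: their number may exceed `k`, but few columns are
-- touched there.
Ξ≤2*touches : ∀ Ds τ a → Ξ Ds τ a ≤ touches (concat Ds) τ a + touches (concat Ds) τ a
Ξ≤2*touches Ds τ a = begin
  Ξ Ds τ a                                                  ≤⟨ ∑-mono Ds (λ {D} _ → ∑-mono D λ {c} _ → +-mono-≤
    (⟦⟧-mono (L.extreme? D τ a c) (touched? τ a c) proj₁) (⟦⟧-mono (R.extreme? D τ a c) (touched? τ a c) proj₁)) ⟩
  ∑ (∑ (λ c → ⟦ touched? τ a c ⟧ + ⟦ touched? τ a c ⟧)) Ds  ≡⟨ ∑-concat _ Ds ⟨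
  ∑ (λ c → ⟦ touched? τ a c ⟧ + ⟦ touched? τ a c ⟧) (concat Ds) ≡⟨ ∑-+ _ _ (concat Ds) ⟩
  touches (concat Ds) τ a + touches (concat Ds) τ a         ∎
  where open ≤-Reasoning

-- Sealed blocks

-- Going outwards from B, only the first column ever touched can be later than all columns before it.
Sealed : List ℕ → State → Set
Sealed B τ = ∀ {a c d} → a ∈ B → c ∉ B → (∀ {e} → e ∉ B → OnWay a c e → τ e < τ c) →
             d ∉ B → OnWay a c d → τ d ≡ 0

module _ {B : List ℕ} (B-consecutive : Consecutive B) where

  -- A key outside the interval `B` has all of `B` on one side, so the starting point within `B`
  -- does not matter.
  onWay-move : ∀ {a b c d} → a ∈ B → b ∈ B → d ∉ B → OnWay a c d → OnWay b c d
  onWay-move a∈ b∈ d∉ w with consecutive⇒oneSided B-consecutive d∉ | w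
  ... | inj₁ d< | inj₁ (a≤d , d<c) = contradiction (d< a∈) (≤⇒≯ a≤d)
  ... | inj₂ <d | inj₁ (a≤d , d<c) = inj₁ (<⇒≤ (<d b∈) , d<c)
  ... | inj₁ d< | inj₂ (c<d , d≤a) = inj₂ (c<d , <⇒≤ (d< b∈))
  ... | inj₂ <d | inj₂ (c<d , d≤a) = contradiction (<d a∈) (≤⇒≯ d≤a)

  -- The first access into the fresh block must touch `c`; a column before `c` with positive time
  -- would force another touch in front of `c`, tying with it.
  seal : ∀ {τ b τ′} → Step τ b τ′ → b ∈ B → (∀ {x} → x ∈ B → τ x ≡ 0) → Sealed B τ′
  seal {τ} {b} {τ′} s b∈ zeroB {a} {c} {d} a∈ c∉ exposed d∉ w with touched? τ b c
  -- If `c` is not touched in this step, its time stays. Columns of `B` have time 0 and the others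
  -- on the way are earlier, so `c` would be touched after all.
  ... | no ¬t = ⊥-elim (¬t (0<τc , clear))
    where
    open Step s
    τ′c≡τc : τ′ c ≡ τ c
    τ′c≡τc = unchanged (λ { refl → c∉ b∈ }) ¬t
    0<τc : 0 < τ c
    0<τc = subst (0 <_) τ′c≡τc (≤-<-trans z≤n (exposed d∉ w))
    clear : ∀ {e} → OnWay b c e → τ e < τ c
    clear {e} w′ with τ e ≟ 0
    ... | yes z = subst (_< τ c) (sym z) 0<τc
    ... | no nz = ≤-<-trans (τ≤τ′ e) (subst (τ′ e <_) τ′c≡τc
                    (exposed (nz ∘ zeroB) (onWay-move b∈ a∈ (nz ∘ zeroB) w′)))
  ... | yes tc with τ d ≟ 0
  ...   | yes z = Step.zero-stays s (λ { refl → d∉ b∈ }) z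
  -- A positive time at `d` yields a touched `e` at `d` or nearer to `b`. It lies on the way to `c`
  -- with the same new time, although `c` must be strictly later.
  ...   | no nz = ⊥-elim (impossible (touched-towards τ b d (n≢0⇒n>0 nz)))
    where
    open Step s
    hidden : ∀ {e} → Touched τ b e → ¬ OnWay b c e
    hidden {e} te w′ = <-irrefl (trans (renewed te) (sym (renewed tc))) (exposed e∉ (onWay-move b∈ a∈ e∉ w′))
      where
      e∉ : e ∉ B
      e∉ e∈ = <-irrefl (sym (zeroB e∈)) (proj₁ te)
    impossible : ¬ (∃[ e ] (Touched τ b e × (e ≡ d ⊎ OnWay b d e)))
    impossible (e , te , inj₁ refl) = hidden te (onWay-move a∈ b∈ d∉ w)
    impossible (e , te , inj₂ w′)   = hidden te (onWay-trans (onWay-move a∈ b∈ d∉ w) w′)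

  -- The premise after the step implies the premise before: a touched `c` was later than all on its
  -- way, any other `c` kept its time while the rest only grew. Time 0 outside `B` persists.
  sealed-step : ∀ {τ b τ′} → Step τ b τ′ → b ∈ B → Sealed B τ → Sealed B τ′
  sealed-step {τ} {b} {τ′} s b∈ sealed {a} {c} {d} a∈ c∉ exposed d∉ w =
    Step.zero-stays s (λ { refl → d∉ b∈ }) (sealed a∈ c∉ exposed-before d∉ w)
    where
    open Step s
    exposed-before : ∀ {e} → e ∉ B → OnWay a c e → τ e < τ c
    exposed-before e∉ w′ with touched? τ b c
    ... | yes (_ , clear) = clear (onWay-move a∈ b∈ e∉ w′)
    ... | no ¬t = ≤-<-trans (τ≤τ′ _) (subst (_ <_) (unchanged (λ { refl → c∉ b∈ }) ¬t) (exposed e∉ w′))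

  sealed-run : ∀ {cols xs τ τ′ w} → Run cols τ xs τ′ w → (∀ {x} → x ∈ xs → x ∈ B) → Sealed B τ → Sealed B τ′
  sealed-run []      xs⊆B sealed = sealed
  sealed-run (s ∷ r) xs⊆B sealed = sealed-run r (xs⊆B ∘ there) (sealed-step s (xs⊆B (here refl)) sealed)

  seal-run : ∀ {cols xs τ τ′ w} → NonEmpty xs → Run cols τ xs τ′ w → (∀ {x} → x ∈ xs → x ∈ B) →
             (∀ {x} → x ∈ B → τ x ≡ 0) → Sealed B τ′
  seal-run _ (s ∷ r) xs⊆B zeroB = sealed-run r (xs⊆B ∘ there) (seal s (xs⊆B (here refl)) zeroB)

  -- The farther of two touched columns on one side is later than all on its way, so sealing gives
  -- the nearer one time 0.
  sealed-touched : ∀ {τ a c d} → Sealed B τ → a ∈ B → c ∉ B → d ∉ B →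
                   Touched τ a c → Touched τ a d → ¬ OnWay a c d
  sealed-touched sealed a∈ c∉ d∉ (_ , clear) (pos , _) w =
    <-irrefl (sym (sealed a∈ c∉ (λ _ → clear) d∉ w)) pos

  sealed-touches : ∀ {τ a O} → Sealed B τ → a ∈ B → Unique O → (∀ {c} → c ∈ O → c ∉ B) → touches O τ a ≤ 2
  sealed-touches {τ} {a} {O} sealed a∈ O! O∉B = begin
    touches O τ a                                        ≤⟨ ∑-mono O split-sides ⟩
    ∑ (λ c → ⟦ right? c ⟧ + ⟦ left? c ⟧) O               ≡⟨ ∑-+ _ _ O ⟩
    ∑ (λ c → ⟦ right? c ⟧) O + ∑ (λ c → ⟦ left? c ⟧) O   ≤⟨ +-mono-≤ (∑-unique right? O! right-unique) (∑-unique left? O! left-unique) ⟩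
    2                                                    ∎
    where
    open ≤-Reasoning
    right? : ∀ c → Dec (Touched τ a c × a < c)
    right? c = touched? τ a c ×-dec (a <? c)
    left? : ∀ c → Dec (Touched τ a c × c < a)
    left? c = touched? τ a c ×-dec (c <? a)
    split-sides : ∀ {c} → c ∈ O → ⟦ touched? τ a c ⟧ ≤ ⟦ right? c ⟧ + ⟦ left? c ⟧
    split-sides {c} c∈ with <-cmp a c
    ... | tri< a<c _ _  = ≤-trans (⟦⟧-mono (touched? τ a c) (right? c) (_, a<c)) (m≤m+n _ _)
    ... | tri≈ _ refl _ = contradiction a∈ (O∉B c∈)
    ... | tri> _ _ c<a  = ≤-trans (⟦⟧-mono (touched? τ a c) (left? c) (_, c<a)) (m≤n+m _ _)
    right-unique : ∀ {c d} → c ∈ O → d ∈ O → Touched τ a c × a < c → Touched τ a d × a < d → c ≡ d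
    right-unique {c} {d} c∈ d∈ (tc , a<c) (td , a<d) with <-cmp c d
    ... | tri< c<d _ _ = ⊥-elim (sealed-touched sealed a∈ (O∉B d∈) (O∉B c∈) td tc (inj₁ (<⇒≤ a<c , c<d)))
    ... | tri≈ _ eq _  = eq
    ... | tri> _ _ d<c = ⊥-elim (sealed-touched sealed a∈ (O∉B c∈) (O∉B d∈) tc td (inj₁ (<⇒≤ a<d , d<c)))
    left-unique : ∀ {c d} → c ∈ O → d ∈ O → Touched τ a c × c < a → Touched τ a d × d < a → c ≡ d
    left-unique {c} {d} c∈ d∈ (tc , c<a) (td , d<a) with <-cmp c d
    ... | tri< c<d _ _ = ⊥-elim (sealed-touched sealed a∈ (O∉B c∈) (O∉B d∈) tc td (inj₂ (c<d , <⇒≤ d<a)))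
    ... | tri≈ _ eq _  = eq
    ... | tri> _ _ d<c = ⊥-elim (sealed-touched sealed a∈ (O∉B d∈) (O∉B c∈) td tc (inj₂ (d<c , <⇒≤ c<a)))

-- The amortised bound along the decomposition

-- Parts keep their own keys instead of normalised patterns, so every subtree is a set of actual
-- columns.
data BlockTree (k : ℕ) : List ℕ → Set where
  leaf : ∀ x → BlockTree k [ x ]
  node : ∀ parts → 1 ≤ length parts → length parts ≤ k → All NonEmpty parts → All Consecutive parts →
         All (BlockTree k) parts → BlockTree k (concat parts)

module _ (cols : List ℕ) (cols! : Unique cols) (k : ℕ) where

  -- 2 (m - 1) + 4: after the first of m ≤ k parts, an access touches at most two extreme columns in
  -- each sibling and at most two columns, counted twice, outside the parent.
  credit : ℕ
  credit = 2 * k + 2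

  -- `1` for the accessed point, `2` for the largest potential of a single column, and `credit` as
  -- surplus for the next part.
  rate : ℕ
  rate = 3 + credit

  -- M pays for the first access of B; the later ones are paid by rate. The surplus credit of each
  -- part pays for the first access of the next.
  Bounded : List ℕ → Set
  Bounded B = ∀ {Ds τ τ′ w M} → Consecutive B → All Consecutive Ds → cols ↭ B ++ concat Ds →
    (∀ {b} → b ∈ B → τ b ≡ 0) → (∀ {a} → a ∈ B → Ξ Ds τ a ≤ M) → Run cols τ B τ′ w →
    w + (potential B τ′ + Φ Ds τ′) + credit ≤ Φ Ds τ + M + rate * length B

  leaf-bounded : ∀ x → Bounded [ x ]
  leaf-bounded x {Ds} {τ} {τ′} {M = M} B-cons Ds-cons perm zeroB fewExtremes (s ∷ []) = begin
    suc (touches cols τ x) + 0 + (potential [ x ] τ′ + Φ Ds τ′) + credit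
      -- The column `x` is fresh, hence not touched, so every touch falls in `Ds`.
      ≡⟨ cong (λ n → suc n + 0 + (potential [ x ] τ′ + Φ Ds τ′) + credit) touches-outside ⟩
    suc (touches (concat Ds) τ x) + 0 + (potential [ x ] τ′ + Φ Ds τ′) + credit
      ≡⟨ regroup (touches (concat Ds) τ x) (potential [ x ] τ′) (Φ Ds τ′) credit ⟩
    potential [ x ] τ′ + (touches (concat Ds) τ x + Φ Ds τ′) + (1 + credit)
      ≤⟨ +-monoˡ-≤ (1 + credit) (+-mono-≤ potential≤2 (≤-trans (amortised-all Ds s oneSided) (+-monoʳ-≤ (Φ Ds τ) (fewExtremes (here refl))))) ⟩
    2 + (Φ Ds τ + M) + (1 + credit)
      ≡⟨ regroup′ (Φ Ds τ + M) credit ⟩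
    Φ Ds τ + M + rate * 1 ∎
    where
    open ≤-Reasoning
    regroup : ∀ t p f c → suc t + 0 + (p + f) + c ≡ p + (t + f) + (1 + c)
    regroup = solve-∀
    regroup′ : ∀ m c → 2 + m + (1 + c) ≡ m + (3 + c) * 1
    regroup′ = solve-∀
    potential≤2 : potential [ x ] τ′ ≤ 2
    potential≤2 = ∑-const [ x ] λ {c} _ → +-mono-≤ (⟦⟧≤1 (L.exposed? [ x ] τ′ c)) (⟦⟧≤1 (R.exposed? [ x ] τ′ c))
    touches-outside : touches cols τ x ≡ touches (concat Ds) τ x
    touches-outside = trans (∑-↭ _ perm) (cong (_+ touches (concat Ds) τ x)
      (⟦⟧-false (touched? τ x x) λ t → <-irrefl (sym (zeroB (here refl))) (proj₁ t)))
    unique : Unique (x ∷ concat Ds)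
    unique = Unique-resp-↭ (setoid ℕ) (↭⇒↭ₛ perm) cols!
    oneSided : ∀ {D} → D ∈ Ds → OneSided x D
    oneSided D∈ = consecutive⇒oneSided (lookup Ds-cons D∈)
      λ x∈D → unique-++⇒∉ [ x ] unique (here refl) (∈-concat⁺′ x∈D D∈)

  module Node {parts Ds : List (List ℕ)} (parts≤k : length parts ≤ k)
    (parts-cons : All Consecutive parts) (B-cons : Consecutive (concat parts)) (Ds-cons : All Consecutive Ds)
    (perm : cols ↭ concat parts ++ concat Ds) where

    B : List ℕ
    B = concat parts

    all-unique : Unique (B ++ concat Ds)
    all-unique = Unique-resp-↭ (setoid ℕ) (↭⇒↭ₛ perm) cols!

    module Part {pre p post} (parts≡ : parts ≡ pre ++ p ∷ post) where

      -- The outside of the part `p`: its siblings, then the outside of the parent.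
      context : List (List ℕ)
      context = pre ++ post ++ Ds

      parts++Ds : parts ++ Ds ≡ pre ++ p ∷ post ++ Ds
      parts++Ds = trans (cong (_++ Ds) parts≡) (++-assoc pre (p ∷ post) Ds)

      p-cons : Consecutive p
      p-cons = lookup parts-cons (subst (p ∈_) (sym parts≡) (∈-++⁺ʳ pre (here refl)))

      context-cons : All Consecutive context
      context-cons = Allₚ.++⁺ (Allₚ.++⁻ˡ pre cons) (Allₚ.++⁺ (All.tail (Allₚ.++⁻ʳ pre cons)) Ds-cons)
        where cons = subst (All Consecutive) parts≡ parts-cons

      p-perm : cols ↭ p ++ concat context
      p-perm = ↭-trans perm (↭-trans (↭-reflexive (trans (concat-++ parts Ds) (cong concat parts++Ds)))
                                     (concat-extract pre p))

      p∈B : ∀ {x} → x ∈ p → x ∈ B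
      p∈B x∈ = ∈-concat⁺′ x∈ (subst (p ∈_) (sym parts≡) (∈-++⁺ʳ pre (here refl)))

      sealed-extremes : ∀ {τ a} → Sealed B τ → a ∈ p → Ξ context τ a ≤ credit
      sealed-extremes {τ} {a} sealed a∈ = begin
        Ξ context τ a                          ≡⟨ ∑-++ _ pre (post ++ Ds) ⟩
        Ξ pre τ a + Ξ (post ++ Ds) τ a         ≡⟨ cong (Ξ pre τ a +_) (∑-++ _ post Ds) ⟩
        Ξ pre τ a + (Ξ post τ a + Ξ Ds τ a)    ≤⟨ +-mono-≤ (siblings pre (Allₚ.++⁻ˡ pre cons))
                                                   (+-mono-≤ (siblings post (All.tail (Allₚ.++⁻ʳ pre cons))) outer) ⟩
        2 * length pre + (2 * length post + 4) ≡⟨ regroup (length pre) (length post) ⟩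
        2 * (length pre + suc (length post)) + 2 ≡⟨ cong (λ n → 2 * n + 2) (trans (cong length parts≡) (length-++ pre)) ⟨
        2 * length parts + 2                   ≤⟨ +-monoˡ-≤ 2 (*-monoʳ-≤ 2 parts≤k) ⟩
        credit                                 ∎
        where
        open ≤-Reasoning
        cons = subst (All Consecutive) parts≡ parts-cons
        regroup : ∀ x y → 2 * x + (2 * y + 4) ≡ 2 * (x + suc y) + 2
        regroup = solve-∀
        siblings : ∀ Es → All Consecutive Es → Ξ Es τ a ≤ 2 * length Es
        siblings Es Es-cons = ∑-const Es λ D∈ → extremes≤2 {τ} {a} (consecutive⇒unique (lookup Es-cons D∈))
        outside≤2 : touches (concat Ds) τ a ≤ 2
        outside≤2 = sealed-touches B-cons sealed (p∈B a∈) (unique-++⁻ʳ B all-unique)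
          λ c∈Ds c∈B → unique-++⇒∉ B all-unique c∈B c∈Ds
        outer : Ξ Ds τ a ≤ 4
        outer = ≤-trans (Ξ≤2*touches Ds τ a) (+-mono-≤ outside≤2 outside≤2)

      Φ-extract : ∀ τ → Φ (parts ++ Ds) τ ≡ potential p τ + Φ context τ
      Φ-extract τ = trans (cong (λ Es → Φ Es τ) parts++Ds)
        (trans (∑-++ _ pre _) (trans (swap (Φ pre τ) (potential p τ) _) (cong (potential p τ +_) (sym (∑-++ _ pre _)))))
        where
        swap : ∀ x y z → x + (y + z) ≡ y + (x + z)
        swap = solve-∀

    -- Induction over the parts still to come, which are untouched while `B` is sealed. No credit
    -- shows in the statement: each part receives it and hands it on.
    later-bounded : ∀ pre ps → parts ≡ pre ++ ps → All Bounded ps → ∀ {τ τ′ w} →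
      Sealed B τ → (∀ {b} → b ∈ concat ps → τ b ≡ 0) → Run cols τ (concat ps) τ′ w →
      w + Φ (parts ++ Ds) τ′ ≤ Φ (parts ++ Ds) τ + rate * length (concat ps)
    later-bounded pre []       parts≡ []         {τ} sealed zeros [] = m≤m+n _ _
    later-bounded pre (p ∷ ps) parts≡ (bp ∷ bps) {τ} {τ″} sealed zeros run
      with run-++⁻ cols p run
    -- `credit` stands on both sides: it serves as `M` for `p`, and the bound for `p` restores it.
    ... | τ′ , w₁ , w₂ , r₁ , r₂ , refl = +-cancelʳ-≤ credit _ _ (begin
      w₁ + w₂ + Φ (parts ++ Ds) τ″ + credit
        ≡⟨ regroup w₁ w₂ _ credit ⟩
      w₁ + credit + (w₂ + Φ (parts ++ Ds) τ″)
        ≤⟨ +-monoʳ-≤ (w₁ + credit) rest ⟩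
      w₁ + credit + (Φ (parts ++ Ds) τ′ + rate * length (concat ps))
        ≡⟨ cong (λ n → w₁ + credit + (n + rate * length (concat ps))) (Φ-extract τ′) ⟩
      w₁ + credit + (potential p τ′ + Φ context τ′ + rate * length (concat ps))
        ≡⟨ regroup′ w₁ credit (potential p τ′ + Φ context τ′) _ ⟩
      w₁ + (potential p τ′ + Φ context τ′) + credit + rate * length (concat ps)
        ≤⟨ +-monoˡ-≤ _ (bp p-cons context-cons p-perm (zeros ∘ ∈-++⁺ˡ) (sealed-extremes sealed) r₁) ⟩
      Φ context τ + credit + rate * length p + rate * length (concat ps)
        ≤⟨ +-monoˡ-≤ _ (+-monoˡ-≤ _ (+-monoˡ-≤ credit (≤-trans (m≤n+m _ (potential p τ)) (≤-reflexive (sym (Φ-extract τ)))))) ⟩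
      Φ (parts ++ Ds) τ + credit + rate * length p + rate * length (concat ps)
        ≡⟨ regroup″ (Φ (parts ++ Ds) τ) credit rate (length p) _ ⟩
      Φ (parts ++ Ds) τ + rate * (length p + length (concat ps)) + credit
        ≡⟨ cong (λ n → Φ (parts ++ Ds) τ + rate * n + credit) (length-++ p) ⟨
      Φ (parts ++ Ds) τ + rate * length (p ++ concat ps) + credit ∎)
      where
      open ≤-Reasoning
      open Part {pre} {p} {ps} parts≡
      regroup : ∀ a b f c → a + b + f + c ≡ a + c + (b + f)
      regroup = solve-∀
      regroup′ : ∀ a c f r → a + c + (f + r) ≡ a + f + c + r
      regroup′ = solve-∀
      regroup″ : ∀ f c r x y → f + c + r * x + r * y ≡ f + r * (x + y) + c
      regroup″ = solve-∀
      ps-zero : ∀ {b} → b ∈ concat ps → τ′ b ≡ 0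
      ps-zero b∈ = run-zero cols r₁ (λ b∈p → unique-++⇒∉ p p-unique b∈p
          (∈-resp-↭ (↭-reflexive (concat-++ pre (ps ++ Ds))) (∈-++⁺ʳ (concat pre)
            (∈-resp-↭ (↭-reflexive (concat-++ ps Ds)) (∈-++⁺ˡ b∈)))))
        (zeros (∈-++⁺ʳ p b∈))
        where
        p-unique : Unique (p ++ concat context)
        p-unique = Unique-resp-↭ (setoid ℕ) (↭⇒↭ₛ p-perm) cols!
      rest : w₂ + Φ (parts ++ Ds) τ″ ≤ Φ (parts ++ Ds) τ′ + rate * length (concat ps)
      rest = later-bounded (pre ++ [ p ]) ps (trans parts≡ (sym (++-assoc pre [ p ] ps))) bps
        (sealed-run B-cons r₁ p∈B sealed) ps-zero r₂

  -- The first part inherits `M`, because its untouched siblings contribute no extremes. Its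
  -- accesses seal the block, and its surplus `credit` passes through the later parts to become the
  -- surplus of the whole block.
  node-bounded : ∀ parts → 1 ≤ length parts → length parts ≤ k → All NonEmpty parts → All Consecutive parts →
                 All Bounded parts → Bounded (concat parts)
  node-bounded (p ∷ ps) _ parts≤k (p≢[] ∷ _) parts-cons (bp ∷ bps) {Ds} {τ} {τ″} {M = M}
    B-cons Ds-cons perm zeroB fewExtremes run with run-++⁻ cols p run
  ... | τ′ , w₁ , w₂ , r₁ , r₂ , refl = begin
    w₁ + w₂ + (potential B τ″ + Φ Ds τ″) + credit
      -- Merging the finished parts into one block cannot raise the potential.
      ≤⟨ +-monoˡ-≤ credit (+-monoʳ-≤ (w₁ + w₂) (+-monoˡ-≤ (Φ Ds τ″) (potential-concat τ″ (p ∷ ps)))) ⟩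
    w₁ + w₂ + (Φ (p ∷ ps) τ″ + Φ Ds τ″) + credit
      ≡⟨ cong (λ n → w₁ + w₂ + n + credit) (∑-++ _ (p ∷ ps) Ds) ⟨
    w₁ + w₂ + Φ (p ∷ ps ++ Ds) τ″ + credit
      ≡⟨ regroup w₁ w₂ _ credit ⟩
    w₁ + credit + (w₂ + Φ (p ∷ ps ++ Ds) τ″)
      ≤⟨ +-monoʳ-≤ (w₁ + credit) (later-bounded [ p ] ps refl bps
           (seal-run B-cons p≢[] r₁ p∈B zeroB) ps-zero r₂) ⟩
    w₁ + credit + (Φ (p ∷ ps ++ Ds) τ′ + rate * length (concat ps))
      ≡⟨ regroup′ w₁ credit (Φ (p ∷ ps ++ Ds) τ′) _ ⟩
    w₁ + Φ (p ∷ ps ++ Ds) τ′ + credit + rate * length (concat ps)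
      ≤⟨ +-monoˡ-≤ _ (bp p-cons context-cons p-perm (zeroB ∘ ∈-++⁺ˡ) fewExtremes′ r₁) ⟩
    Φ (ps ++ Ds) τ + M + rate * length p + rate * length (concat ps)
      ≡⟨ cong (λ n → n + M + rate * length p + rate * length (concat ps)) Φ-fresh ⟩
    Φ Ds τ + M + rate * length p + rate * length (concat ps)
      ≡⟨ regroup″ (Φ Ds τ + M) rate (length p) _ ⟩
    Φ Ds τ + M + rate * (length p + length (concat ps))
      ≡⟨ cong (λ n → Φ Ds τ + M + rate * n) (length-++ p) ⟨
    Φ Ds τ + M + rate * length B ∎
    where
    open ≤-Reasoning
    open Node {p ∷ ps} {Ds} parts≤k parts-cons B-cons Ds-cons perm
    open Part {[]} {p} {ps} refl
    regroup : ∀ a b f c → a + b + f + c ≡ a + c + (b + f)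
    regroup = solve-∀
    regroup′ : ∀ a c f r → a + c + (f + r) ≡ a + f + c + r
    regroup′ = solve-∀
    regroup″ : ∀ f r x y → f + r * x + r * y ≡ f + r * (x + y)
    regroup″ = solve-∀
    ps-fresh : ∀ {D c} → D ∈ ps → c ∈ D → τ c ≡ 0
    ps-fresh D∈ c∈ = zeroB (∈-++⁺ʳ p (∈-concat⁺′ c∈ D∈))
    Φ-fresh : Φ (ps ++ Ds) τ ≡ Φ Ds τ
    Φ-fresh = trans (∑-++ _ ps Ds) (cong (_+ Φ Ds τ) (∑-zero ps λ {D} D∈ → zero⇒potential≡0 D (ps-fresh D∈)))
    fewExtremes′ : ∀ {a} → a ∈ p → Ξ (ps ++ Ds) τ a ≤ M
    fewExtremes′ {a} a∈ = ≤-trans (≤-reflexive (trans (∑-++ _ ps Ds)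
      (cong (_+ Ξ Ds τ a) (∑-zero ps λ {D} D∈ → zero⇒extremes≡0 D (ps-fresh D∈))))) (fewExtremes (∈-++⁺ˡ a∈))
    ps-zero : ∀ {b} → b ∈ concat ps → τ′ b ≡ 0
    ps-zero b∈ = run-zero cols r₁ (λ b∈p → unique-++⇒∉ p p-unique b∈p
        (∈-resp-↭ (↭-reflexive (concat-++ ps Ds)) (∈-++⁺ˡ b∈)))
      (zeroB (∈-++⁺ʳ p b∈))
      where
      p-unique : Unique (p ++ concat context)
      p-unique = Unique-resp-↭ (setoid ℕ) (↭⇒↭ₛ p-perm) cols!

  mutual
    bounded : ∀ {B} → BlockTree k B → Bounded B
    bounded (leaf x) = leaf-bounded x
    bounded (node parts 1≤ ≤k nonempty cons trees) = node-bounded parts 1≤ ≤k nonempty cons (all-bounded trees)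

    all-bounded : ∀ {ps} → All (BlockTree k) ps → All Bounded ps
    all-bounded []       = []
    all-bounded (t ∷ ts) = bounded t ∷ all-bounded ts

-- Blocks of a decomposable permutation as actual sets of keys

rank-applyUpTo : ∀ f n i x → i ≤ n → (∀ {j} → j < i → f j < x) → (∀ {j} → i ≤ j → x ≤ f j) →
                 length (filter (λ y → y <? x) (applyUpTo f n)) ≡ i
rank-applyUpTo f n zero x _ below above
  rewrite filter-none (λ y → y <? x) (Allₚ.applyUpTo⁺₂ f n λ j → ≤⇒≯ (above {j} z≤n)) = refl
rank-applyUpTo f (suc n) (suc i) x (s≤s i≤n) below above
  rewrite filter-accept (λ y → y <? x) {xs = applyUpTo (f ∘ suc) n} (below z<s) =
  cong suc (rank-applyUpTo (f ∘ suc) n i x i≤n (below ∘ s≤s) (above ∘ s≤s))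

-- In an interval starting at `lo`, the rank of a key is its distance from `lo`.
consecutive-std : ∀ {p} ((lo , _) : Consecutive p) → map (lo +_) (std p) ≡ p
consecutive-std {p} (lo , perm) = trans (sym (map-∘ p)) (map-id-local (All.tabulate rank))
  where
  rank : ∀ {x} → x ∈ p → lo + length (filter (λ y → y <? x) p) ≡ x
  rank {x} x∈ with ∈-applyUpTo⁻ (lo +_) (∈-resp-↭ perm x∈)
  ... | i , i<n , refl = cong (lo +_) (trans (↭-length (filter-↭ (λ y → y <? (lo + i)) perm))
    (rank-applyUpTo (lo +_) (length p) i (lo + i) (<⇒≤ i<n) (+-monoʳ-< lo) (+-monoʳ-≤ lo)))

shift-+ : ∀ m n xs → map (m +_) (map (n +_) xs) ≡ map ((m + n) +_) xs
shift-+ m n xs = trans (sym (map-∘ xs)) (map-cong (λ x → sym (+-assoc m n x)) xs)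

consecutive-shift : ∀ m {p} → Consecutive p → Consecutive (map (m +_) p)
consecutive-shift m {p} (lo , perm) = m + lo , ↭-trans (map⁺ (m +_) perm) (↭-reflexive (begin
  map (m +_) (applyUpTo (lo +_) (length p))    ≡⟨ cong (map (m +_)) (map-upTo (lo +_) (length p)) ⟨
  map (m +_) (map (lo +_) (upTo (length p)))   ≡⟨ shift-+ m lo _ ⟩
  map ((m + lo) +_) (upTo (length p))          ≡⟨ map-upTo _ (length p) ⟩
  applyUpTo ((m + lo) +_) (length p)           ≡⟨ cong (applyUpTo ((m + lo) +_)) (length-map (m +_) p) ⟨
  applyUpTo ((m + lo) +_) (length (map (m +_) p)) ∎))
  where open ≡-Reasoning

mutual
  -- `m` accumulates the offsets removed by `std`: descending into a part adds the least key of its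
  -- interval.
  blockTree : ∀ {k σ} m → KDecomposable k σ → BlockTree k (map (m +_) σ)
  blockTree m (single x) = leaf (m + x)
  blockTree {k} m (split _ parts refl 2≤ ≤k nonempty cons decs) = subst (BlockTree k) (concat-map parts)
    (node (map (map (m +_)) parts) (subst (1 ≤_) (sym len) (<⇒≤ 2≤)) (subst (_≤ k) (sym len) ≤k)
      (Allₚ.map⁺ (All.map (λ {p} → subst (1 ≤_) (sym (length-map (m +_) p))) nonempty))
      (Allₚ.map⁺ (All.map (consecutive-shift m) cons))
      (blockTrees m cons decs))
    where
    len : length (map (map (m +_)) parts) ≡ length parts
    len = length-map (map (m +_)) parts

  blockTrees : ∀ {k parts} m → All Consecutive parts → All (λ p → KDecomposable k (std p)) parts →
               All (BlockTree k) (map (map (m +_)) parts)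
  blockTrees m []           []           = []
  blockTrees {k} m (_∷_ {x = p} c cs) (d ∷ ds) =
    subst (BlockTree k) (trans (sym (shift-+ m (proj₁ c) (std p))) (cong (map (m +_)) (consecutive-std c)))
      (blockTree (m + proj₁ c) d) ∷ blockTrees m cs ds

-- Greedy on points

lastTouch : List Point → State
lastTouch P c = maybe′ suc 0 (tau P c)

∈⇒<lastTouch : ∀ P {c s} → (c , s) ∈ P → s < lastTouch P c
∈⇒<lastTouch ((x , s) ∷ P) (here refl) with tau P x | x ≡ᵇ x | ≡⇒≡ᵇ x x refl
... | nothing | true | _ = ≤-refl
... | just r  | true | _ = s≤s (m≤m⊔n s r)
∈⇒<lastTouch ((x , s′) ∷ P) {c} (there q∈) with tau P c | x ≡ᵇ c | ∈⇒<lastTouch P q∈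
... | r       | false | h       = h
... | just r  | true  | s≤s s≤r = s≤s (≤-trans s≤r (m≤n⊔m s′ r))

lastTouch-∈ : ∀ P {c s} → lastTouch P c ≡ suc s → (c , s) ∈ P
-- The induction hypothesis is abstracted along with `tau P c`, so that it speaks of the same value
-- in each branch.
lastTouch-∈ ((x , s′) ∷ P) {c} eq with tau P c | x ≡ᵇ c in x≡c | (λ s → lastTouch-∈ P {c} {s})
... | r       | false | rec = there (rec _ eq)
lastTouch-∈ ((x , s′) ∷ P) {c} refl | nothing | true | rec =
  here (cong (_, s′) (sym (≡ᵇ⇒≡ x c (subst T (sym x≡c) _))))
lastTouch-∈ ((x , s′) ∷ P) {c} refl | just r | true | rec with ⊔-sel s′ r
... | inj₁ e rewrite e = here (cong (_, s′) (sym (≡ᵇ⇒≡ x c (subst T (sym x≡c) _))))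
... | inj₂ e rewrite e = there (rec _ refl)

lastTouch-≤ : ∀ P {c t} → (∀ {s} → (c , s) ∈ P → s < t) → lastTouch P c ≤ t
lastTouch-≤ P {c} h with lastTouch P c in eq
... | zero  = z≤n
... | suc s = h (lastTouch-∈ P eq)

allB⁻ : ∀ {A : Set} (f : A → Bool) xs {x} → T (allB f xs) → x ∈ xs → T (f x)
allB⁻ f (x ∷ xs) h (here refl) = proj₁ (Equivalence.to (T-∧ {f x}) h)
allB⁻ f (x ∷ xs) h (there x∈)  = allB⁻ f xs (proj₂ (Equivalence.to (T-∧ {f x}) h)) x∈

allB⁺ : ∀ {A : Set} (f : A → Bool) xs → (∀ {x} → x ∈ xs → T (f x)) → T (allB f xs)
allB⁺ f []       h = _
allB⁺ f (x ∷ xs) h = Equivalence.from (T-∧ {f x}) (h (here refl) , allB⁺ f xs (h ∘ there))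

inRect⁻ : ∀ a t b u x s → T (inRect a t b u (x , s)) → a ⊓ b ≤ x × x ≤ a ⊔ b × t ⊓ u ≤ s × s ≤ t ⊔ u
inRect⁻ a t b u x s h =
  let h₁ , h′ = Equivalence.to (T-∧ {a ⊓ b ≤ᵇ x}) h
      h₂ , h″ = Equivalence.to (T-∧ {x ≤ᵇ a ⊔ b}) h′
      h₃ , h₄ = Equivalence.to (T-∧ {t ⊓ u ≤ᵇ s}) h″
  in ≤ᵇ⇒≤ _ _ h₁ , ≤ᵇ⇒≤ _ _ h₂ , ≤ᵇ⇒≤ _ _ h₃ , ≤ᵇ⇒≤ _ _ h₄

inRect⁺ : ∀ a t b u x s → a ⊓ b ≤ x → x ≤ a ⊔ b → t ⊓ u ≤ s → s ≤ t ⊔ u → T (inRect a t b u (x , s))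
inRect⁺ a t b u x s h₁ h₂ h₃ h₄ =
  Equivalence.from (T-∧ {a ⊓ b ≤ᵇ x}) (≤⇒≤ᵇ h₁ ,
  Equivalence.from (T-∧ {x ≤ᵇ a ⊔ b}) (≤⇒≤ᵇ h₂ ,
  Equivalence.from (T-∧ {t ⊓ u ≤ᵇ s}) (≤⇒≤ᵇ h₃ , ≤⇒≤ᵇ h₄)))

onWay⇒between : ∀ {a b x} → OnWay a b x → a ⊓ b ≤ x × x ≤ a ⊔ b
onWay⇒between {a} {b} (inj₁ (a≤x , x<b)) = ≤-trans (m⊓n≤m a b) a≤x , ≤-trans (<⇒≤ x<b) (m≤n⊔m a b)
onWay⇒between {a} {b} (inj₂ (b<x , x≤a)) = ≤-trans (m⊓n≤n a b) (<⇒≤ b<x) , ≤-trans x≤a (m≤m⊔n a b)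

between⇒onWay : ∀ a b {x} → a ⊓ b ≤ x → x ≤ a ⊔ b → x ≡ b ⊎ OnWay a b x
between⇒onWay a b {x} h₁ h₂ with <-cmp x b
... | tri≈ _ x≡b _ = inj₁ x≡b
... | tri< x<b _ _ with ≤-total a b
...   | inj₁ a≤b = inj₂ (inj₁ (subst (_≤ x) (m≤n⇒m⊓n≡m a≤b) h₁ , x<b))
...   | inj₂ b≤a = contradiction (subst (_≤ x) (m≥n⇒m⊓n≡n b≤a) h₁) (<⇒≱ x<b)
between⇒onWay a b {x} h₁ h₂ | tri> _ _ b<x with ≤-total a b
...   | inj₁ a≤b = contradiction (subst (x ≤_) (m≤n⇒m⊔n≡n a≤b) h₂) (<⇒≱ b<x)
...   | inj₂ b≤a = inj₂ (inj₂ (b<x , subst (x ≤_) (m≥n⇒m⊔n≡m b≤a) h₂))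

onWay⇒≢ : ∀ {a b x} → OnWay a b x → x ≢ b
onWay⇒≢ (inj₁ (_ , x<b)) = <⇒≢ x<b
onWay⇒≢ (inj₂ (b<x , _)) = >⇒≢ b<x

module _ (P : List Point) (t : ℕ) (earlier : ∀ {c s} → (c , s) ∈ P → s < t) (a : ℕ) where

  -- A last touch on the way at time `u` or later would be a point of the rectangle outside column
  -- `b`.
  touched⇒Touched : ∀ b → T (touched P t a b) → Touched (lastTouch P) a b
  touched⇒Touched b h with a ≡ᵇ b | tau P b in eq
  ... | false | just u = z<s , λ {d} → clear {d}
    where
    clear : ∀ {d} → OnWay a b d → lastTouch P d < suc u
    clear {d} w with lastTouch P d in eqd
    ... | zero  = z<s
    ... | suc s with s <? u
    ...   | yes s<u = s≤s s<u
    ...   | no  s≮u = ⊥-elim (excluded (allB⁻ _ P h (lastTouch-∈ P eqd)))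
      where
      inside : T (inRect a t b u (d , s))
      inside = inRect⁺ a t b u d s (proj₁ (onWay⇒between w)) (proj₂ (onWay⇒between w))
        (≤-trans (m⊓n≤n t u) (≮⇒≥ s≮u)) (≤-trans (<⇒≤ (earlier (lastTouch-∈ P eqd))) (m≤m⊔n t u))
      excluded : ¬ T (not (inRect a t b u (d , s)) ∨ samePoint (d , s) (b , u))
      excluded h′ with inRect a t b u (d , s) | inside
      ... | true | _ = onWay⇒≢ w (≡ᵇ⇒≡ d b (proj₁ (Equivalence.to (T-∧ {d ≡ᵇ b}) h′)))

  -- Points of the rectangle have time at least `u`. On the way this contradicts `clear`; in column
  -- `b` only the last touch remains.
  Touched⇒touched : ∀ b → a ≢ b → Touched (lastTouch P) a b → T (touched P t a b)
  Touched⇒touched b a≢b (pos , clear) with a ≡ᵇ b in a≡b | tau P b in eq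
  ... | true  | _      = a≢b (≡ᵇ⇒≡ a b (subst T (sym a≡b) _))
  ... | false | just u = allB⁺ _ P λ {q} → allowed q
    where
    last-b : lastTouch P b ≡ suc u
    last-b = cong (maybe′ suc 0) eq
    u<t : u < t
    u<t = earlier (lastTouch-∈ P last-b)
    same : ∀ x s → (x , s) ∈ P → T (inRect a t b u (x , s)) → T (samePoint (x , s) (b , u))
    same x s q∈ inside with inRect⁻ a t b u x s inside
    ... | h₁ , h₂ , h₃ , _ with between⇒onWay a b h₁ h₂
    ...   | inj₂ w    = contradiction (<-≤-trans (∈⇒<lastTouch P q∈) (≤-pred (clear w))) (≤⇒≯ u≤s)
      where
      u≤s : u ≤ s
      u≤s = subst (_≤ s) (m≥n⇒m⊓n≡n (<⇒≤ u<t)) h₃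
    ...   | inj₁ refl = Equivalence.from (T-∧ {x ≡ᵇ x}) (≡⇒≡ᵇ x x refl , ≡⇒≡ᵇ s u
              (≤-antisym (≤-pred (subst (s <_) last-b (∈⇒<lastTouch P q∈))) (subst (_≤ s) (m≥n⇒m⊓n≡n (<⇒≤ u<t)) h₃)))
    allowed : ∀ q → q ∈ P → T (not (inRect a t b u q) ∨ samePoint q (b , u))
    allowed (x , s) q∈ with inRect a t b u (x , s) | same x s q∈
    ... | true  | f = f _
    ... | false | _ = _

  module _ (cols : List ℕ) (P⊆cols : ∀ {c s} → (c , s) ∈ P → c ∈ cols) where

    step-∈⁻ : ∀ {c s} → (c , s) ∈ step P t a cols → s ≡ t × (c ≡ a ⊎ (c ∈ cols × Touched (lastTouch P) a c))
    step-∈⁻ (here refl) = refl , inj₁ refl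
    step-∈⁻ (there q∈) with ∈-map⁻ (λ b → (b , t)) q∈
    ... | c , c∈ , refl = refl , inj₂ (map₂ (touched⇒Touched c) (∈-filter⁻ (T? ∘ touched P t a) {xs = cols} c∈))

    P′ : List Point
    P′ = P ++ step P t a cols

    earlier′ : ∀ {c s} → (c , s) ∈ P′ → s < suc t
    earlier′ q∈ with ∈-++⁻ P q∈
    ... | inj₁ q∈P = m≤n⇒m≤1+n (earlier q∈P)
    ... | inj₂ q∈S = s≤s (≤-reflexive (proj₁ (step-∈⁻ q∈S)))

    P′⊆cols : a ∈ cols → ∀ {c s} → (c , s) ∈ P′ → c ∈ cols
    P′⊆cols a∈ q∈ with ∈-++⁻ P q∈
    ... | inj₁ q∈P = P⊆cols q∈P
    ... | inj₂ q∈S with step-∈⁻ q∈S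
    ...   | _ , inj₁ refl     = a∈
    ...   | _ , inj₂ (c∈ , _) = c∈

    greedy-step : Step (lastTouch P) a (lastTouch P′)
    greedy-step = record
      -- `State` shifts times by one, keeping 0 for columns never touched.
      { now       = suc t
      ; τ<now     = λ c → s≤s (lastTouch-≤ P earlier)
      ; accessed  = at-now (∈-++⁺ʳ P (here refl))
      ; renewed   = renewed
      ; unchanged = unchanged
      }
      where
      at-now : ∀ {c} → (c , t) ∈ P′ → lastTouch P′ c ≡ suc t
      at-now q∈ = ≤-antisym (lastTouch-≤ P′ earlier′) (∈⇒<lastTouch P′ q∈)
      present : ∀ {c} → 0 < lastTouch P c → c ∈ cols
      present {c} pos with lastTouch P c in eq
      ... | suc s = P⊆cols (lastTouch-∈ P eq)
      renewed : ∀ {c} → Touched (lastTouch P) a c → lastTouch P′ c ≡ suc t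
      renewed {c} tc with a ≟ c
      ... | yes refl = at-now (∈-++⁺ʳ P (here refl))
      ... | no a≢c   = at-now (∈-++⁺ʳ P (there (∈-map⁺ (λ b → (b , t))
              (∈-filter⁺ (T? ∘ touched P t a) (present (proj₁ tc)) (Touched⇒touched c a≢c tc)))))
      unchanged : ∀ {c} → c ≢ a → ¬ Touched (lastTouch P) a c → lastTouch P′ c ≡ lastTouch P c
      unchanged {c} c≢a ¬tc = ≤-antisym
        (lastTouch-≤ P′ λ q∈ → ∈⇒<lastTouch P (old q∈))
        (lastTouch-≤ P λ q∈ → ∈⇒<lastTouch P′ (∈-++⁺ˡ q∈))
        where
        old : ∀ {s} → (c , s) ∈ P′ → (c , s) ∈ P
        old q∈ with ∈-++⁻ P q∈
        ... | inj₁ q∈P = q∈P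
        ... | inj₂ q∈S with step-∈⁻ q∈S
        ...   | _ , inj₁ c≡a      = contradiction c≡a c≢a
        ...   | _ , inj₂ (_ , tc) = contradiction tc ¬tc

    -- An inequality, since `touches` also counts a previously touched `a`, which `touched` omits.
    length-step : length (step P t a cols) ≤ suc (touches cols (lastTouch P) a)
    length-step = s≤s (≤-trans (≤-reflexive (length-map _ (filter (T? ∘ touched P t a) cols)))
      (length-filter≤∑ (T? ∘ touched P t a) (touched? (lastTouch P) a) (touched⇒Touched _) cols))

-- Links point sets to the abstract `Run`, maintaining the two invariants that `greedy-step`
-- requires.
greedy-run : ∀ cols P t xs → (∀ {c s} → (c , s) ∈ P → s < t) → (∀ {c s} → (c , s) ∈ P → c ∈ cols) →
             (∀ {x} → x ∈ xs → x ∈ cols) →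
             ∃[ τ ] ∃[ w ] (Run cols (lastTouch P) xs τ w × length (run cols P t xs) ≤ length P + w)
greedy-run cols P t []       earlier P⊆ xs⊆ = _ , _ , [] , m≤m+n _ _
greedy-run cols P t (a ∷ xs) earlier P⊆ xs⊆
  with greedy-run cols (P ++ step P t a cols) (suc t) xs (earlier′ P t earlier a cols P⊆)
         (P′⊆cols P t earlier a cols P⊆ (xs⊆ (here refl))) (xs⊆ ∘ there)
... | τ , w , r , le = τ , _ , greedy-step P t earlier a cols P⊆ ∷ r , (begin
  length (run cols (P ++ step P t a cols) (suc t) xs)       ≤⟨ le ⟩
  length (P ++ step P t a cols) + w                         ≡⟨ cong (_+ w) (length-++ P) ⟩
  length P + length (step P t a cols) + w                   ≤⟨ +-monoˡ-≤ w (+-monoʳ-≤ (length P) (length-step P t earlier a cols P⊆)) ⟩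
  length P + suc (touches cols (lastTouch P) a) + w         ≡⟨ +-assoc (length P) _ w ⟩
  length P + (suc (touches cols (lastTouch P) a) + w)       ∎)
  where open ≤-Reasoning

-- Key range and numerical bounds

∈⇒≤max : ∀ {x xs} → x ∈ xs → x ≤ foldr _⊔_ 0 xs
∈⇒≤max {xs = y ∷ ys} (here refl) = m≤m⊔n y _
∈⇒≤max {xs = y ∷ ys} (there x∈)  = ≤-trans (∈⇒≤max x∈) (m≤n⊔m y _)

max-≤ : ∀ {m} xs → (∀ {x} → x ∈ xs → x ≤ m) → foldr _⊔_ 0 xs ≤ m
max-≤ []       h = z≤n
max-≤ (x ∷ xs) h = ⊔-lub (h (here refl)) (max-≤ xs (h ∘ there))

max-upTo : ∀ {m xs} → xs ↭ upTo (suc m) → foldr _⊔_ 0 xs ≡ m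
max-upTo {m} {xs} perm = ≤-antisym (max-≤ xs λ x∈ → ≤-pred (∈-upTo⁻ (∈-resp-↭ perm x∈)))
  (∈⇒≤max (∈-resp-↭ (↭-sym perm) (∈-upTo⁺ (n<1+n m))))

n≤2^n : ∀ n → n ≤ 2 ^ n
n≤2^n zero    = z≤n
n≤2^n (suc n) = +-mono-≤ (m^n>0 2 n) (≤-trans (n≤2^n n) (m≤m+n _ 0))

greedyCost-linear : ∀ k n X → X ↭ upTo n → KDecomposable k X → greedyCost X ≤ (2 * k + 5) * n
-- Separate, because `greedy` scans column 0 even for the empty sequence, so the columns are not a
-- permutation of the keys.
greedyCost-linear k zero    X perm dec with ↭-length perm
greedyCost-linear k zero    [] perm dec | _ = z≤n
greedyCost-linear k (suc m) X perm dec
  with greedy-run (upTo (suc (foldr _⊔_ 0 X))) [] 0 X (λ ()) (λ ()) (λ x∈ → ∈-upTo⁺ (s≤s (∈⇒≤max x∈)))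
... | τ , w , r , le = begin
  greedyCost X   ≤⟨ le ⟩
  w              ≤⟨ m≤m+n w _ ⟩
  w + _          ≤⟨ m≤m+n _ (credit cols cols! k) ⟩
  -- The whole sequence is one block with nothing outside, so `Ds` is empty and `M = 0`; all times
  -- start at 0.
  w + _ + credit cols cols! k ≤⟨ bounded cols cols! k tree {M = 0} X-cons [] cols↭X (λ _ → refl) (λ _ → z≤n) r ⟩
  (3 + (2 * k + 2)) * length X ≡⟨ cong₂ _*_ (shuffle k) (trans (↭-length perm) (length-upTo (suc m))) ⟩
  (2 * k + 5) * suc m ∎
  where
  open ≤-Reasoning
  cols = upTo (suc (foldr _⊔_ 0 X))
  cols! : Unique cols
  cols! = upTo⁺ _
  shuffle : ∀ k → 3 + (2 * k + 2) ≡ 2 * k + 5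
  shuffle = solve-∀
  X-cons : Consecutive X
  X-cons = 0 , subst (λ n → X ↭ upTo n) (sym (trans (↭-length perm) (length-upTo (suc m)))) perm
  tree : BlockTree k X
  tree = subst (BlockTree k) (map-id-local (All.tabulate λ _ → refl)) (blockTree 0 dec)
  cols↭X : cols ↭ X ++ []
  cols↭X = ↭-trans (↭-reflexive (cong (upTo ∘ suc) (max-upTo perm)))
    (↭-trans (↭-sym perm) (↭-reflexive (sym (++-identityʳ X))))

-- In the case `single`, `k` may be 0; the target is then just 1, below the linear bound.
greedyCost-singleton : ∀ x → greedyCost [ x ] ≤ 1
greedyCost-singleton x = ≤-trans (length-step [] 0 (λ ()) x cols (λ ()))
  (s≤s (≤-reflexive (∑-zero cols λ {c} _ → ⟦⟧-false (touched? (lastTouch []) x c) λ ())))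
  where cols = upTo (suc (x ⊔ 0))

2k+5≤5k² : ∀ {k} → 2 ≤ k → 2 * k + 5 ≤ 5 * (k * k)
2k+5≤5k² {k} 2≤k = begin
  -- Here `5 ≤ 12 = 3 * 4 ≤ 3 * (k * k)`; the constant of the theorem is `5 = 2 + 3`.
  2 * k + 5                    ≤⟨ +-mono-≤ (*-monoʳ-≤ 2 k≤k²) (≤-trans (m≤m+n 5 7) (*-monoʳ-≤ 3 4≤k²)) ⟩
  2 * (k * k) + 3 * (k * k)    ≡⟨ *-distribʳ-+ (k * k) 2 3 ⟨
  5 * (k * k)                  ∎
  where
  open ≤-Reasoning
  4≤k² : 4 ≤ k * k
  4≤k² = *-mono-≤ 2≤k 2≤k
  k≤k² : k ≤ k * k
  k≤k² = ≤-trans (≤-reflexive (sym (*-identityˡ k))) (*-monoˡ-≤ k (<⇒≤ 2≤k))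

mainTheorem4 : ∃[ c ] ((k n : ℕ) (X : List ℕ) → X ↭ upTo n → KDecomposable k X
    → greedyCost X ≤ n * 2 ^ (c * (k * k)))
mainTheorem4 = 5 , bound
  where
  open ≤-Reasoning
  bound : (k n : ℕ) (X : List ℕ) → X ↭ upTo n → KDecomposable k X → greedyCost X ≤ n * 2 ^ (5 * (k * k))
  bound k n X perm (single x) = begin
    greedyCost [ x ]            ≤⟨ greedyCost-singleton x ⟩
    1                           ≤⟨ m^n>0 2 (5 * (k * k)) ⟩
    2 ^ (5 * (k * k))           ≡⟨ *-identityˡ _ ⟨
    1 * 2 ^ (5 * (k * k))       ≡⟨ cong (_* 2 ^ (5 * (k * k))) (trans (↭-length perm) (length-upTo n)) ⟩
    n * 2 ^ (5 * (k * k))       ∎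
  -- A `split` has at least two and at most `k` parts, which gives `2 ≤ k`.
  bound k n X perm dec@(split _ _ _ 2≤m m≤k _ _ _) = begin
    greedyCost X                ≤⟨ greedyCost-linear k n X perm dec ⟩
    (2 * k + 5) * n             ≡⟨ *-comm (2 * k + 5) n ⟩
    n * (2 * k + 5)             ≤⟨ *-monoʳ-≤ n (2k+5≤5k² (≤-trans 2≤m m≤k)) ⟩
    n * (5 * (k * k))           ≤⟨ *-monoʳ-≤ n (n≤2^n (5 * (k * k))) ⟩
    n * 2 ^ (5 * (k * k))       ∎
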